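{- For $n\ge1$, the number of permutations in $S_n$ equivalent to the identity $\iota_n=12\cdots n$ under adjacent $\{\{123,321\}\}$-equivalence is $\binom{n-1}{\lfloor (n-1)/2\rfloor}$.
   Context: Permutations are written as words $\pi_1\cdots\pi_n$. An adjacent move on $\pi\in S_n$ chooses three consecutive positions $i,i+1,i+2$ such that $\pi_i<\pi_{i+1}<\pi_{i+2}$ or $\pi_i>\pi_{i+1}>\pi_{i+2}$, and reverses these three entries (replaces $\pi_i\pi_{i+1}\pi_{i+2}$ by $\pi_{i+2}\pi_{i+1}\pi_i$), i.e., replaces pattern $123$ by $321$ or vice versa. Equivalence is the equivalence relation generated by such moves. -}

module Defs where

open import Data.Nat using (ℕ; zero; suc; _<_; _>_)
open import Data.List using (List; []; _∷_; _++_; upTo; length)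
open import Data.List.Relation.Binary.Permutation.Propositional using (_↭_)
open import Data.Product using (_×_; Σ)
open import Data.Sum using (_⊎_)
open import Relation.Binary.Construct.Closure.Equivalence using (EqClosure)

-- A permutation of S_n is written as a word π₁⋯πₙ; we use the values 0,…,n-1
-- (order-isomorphic to 1,…,n, so the moves and equivalence are unchanged).
IsPerm : ℕ → List ℕ → Set
IsPerm n π = π ↭ upTo n

ident : ℕ → List ℕ
ident n = upTo n

Monotone3 : ℕ → ℕ → ℕ → Set
Monotone3 a b c = (a < b × b < c) ⊎ (a > b × b > c)

data Move : List ℕ → List ℕ → Set where
  move : ∀ (u v : List ℕ) (a b c : ℕ) → Monotone3 a b c →
         Move (u ++ a ∷ b ∷ c ∷ v) (u ++ c ∷ b ∷ a ∷ v)

Equiv : List ℕ → List ℕ → Set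
Equiv = EqClosure Move

{-# OPTIONS --safe #-}

-- Every word of the class splits uniquely into consecutive blocks of odd length,
-- each permuting an interval of values.  Inside a block the even positions (counted
-- from the start of the block) hold fixed points, and the odd positions carry an
-- indecomposable 321-avoiding permutation.  Such a word is read from left to right
-- by remembering the queue of values that were jumped over and not yet used: at an
-- odd position the word shows either the front of the queue or a new record.
-- A move exchanges "front of the queue, fixed point, record" with "record, fixed
-- point, front of the queue", and both readings end in the same state, so that the
-- language is closed under moves and every word can be sorted by moves.  The number
-- of words of length suc r that are read from a queue of length h is
-- C(r − h, ⌊r/2⌋), by Pascal's rule.
module Submission where

open import Defs
open import Data.Empty using (⊥-elim)
open import Data.List using (List; []; _∷_; _++_; map; concat; applyUpTo; length)
open import Data.List.Membership.Propositional using (_∈_)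
open import Data.List.Membership.Propositional.Properties
  using (∈-++⁺ˡ; ∈-++⁺ʳ; ∈-++⁻; ∈-map⁺; ∈-map⁻; ∈-concat⁺′; ∈-concat⁻′; ∈-applyUpTo⁺; ∈-applyUpTo⁻)
open import Data.List.Properties using (length-++; length-map; ∷-injectiveˡ; ∷-injectiveʳ)
open import Data.List.Relation.Binary.Disjoint.Propositional using (Disjoint)
open import Data.List.Relation.Binary.Permutation.Propositional using (_↭_; ↭-refl; ↭-trans; ↭-isEquivalence; prep; swap)
open import Data.List.Relation.Binary.Permutation.Propositional.Properties using () renaming (++⁺ˡ to ↭-++⁺ˡ)
open import Data.List.Relation.Unary.All using ([])
open import Data.List.Relation.Unary.All.Properties using () renaming (applyUpTo⁺₂ to All-applyUpTo⁺)
open import Data.List.Relation.Unary.AllPairs using ([]; _∷_)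
open import Data.List.Relation.Unary.AllPairs.Properties using () renaming (applyUpTo⁺₁ to AllPairs-applyUpTo⁺)
open import Data.List.Relation.Unary.Any using (here)
open import Data.List.Relation.Unary.Unique.Propositional using (Unique)
open import Data.List.Relation.Unary.Unique.Propositional.Properties using (++⁺; concat⁺; map⁺)
open import Data.Nat using (ℕ; zero; suc; _+_; _∸_; _/_; _≤_; _<_; z≤n; s≤s; ⌊_/2⌋; ⌈_/2⌉)
open import Data.Nat.Combinatorics using (_C_; nCk≡nC[n∸k]; nCk+nC[k+1]≡[n+1]C[k+1])
open import Data.Nat.DivMod using (m/n≡1+[m∸n]/n)
open import Data.Nat.Properties
open import Data.Product using (Σ; ∃-syntax; _×_; _,_)
open import Data.Sum using (_⊎_; inj₁; inj₂)
open import Data.Unit using (⊤; tt)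
open import Function using (_∘_)
open import Function.Bundles using (_⇔_; mk⇔)
open import Relation.Binary.Construct.Closure.Equivalence using (fold; gmap; return; symmetric)
open import Relation.Binary.Construct.Closure.ReflexiveTransitive using (ε; _◅_; _◅◅_)
open import Relation.Binary.Construct.Closure.Symmetric using (fwd; bwd)
open import Relation.Binary.PropositionalEquality using (_≡_; refl; sym; trans; cong; cong₂; subst; module ≡-Reasoning)
open import Relation.Nullary using (¬_)

private
  variable
    n p x y z : ℕ
    q w w′ : List ℕ

-- The language

-- The next new value at odd position p when the values of q are pending: the
-- positions before p hold all smaller values of their block's parity except q.
next : ℕ → List ℕ → ℕ
next p []      = p
next p (_ ∷ q) = next (2 + p) q

skipped : ℕ → ℕ → List ℕ
skipped m zero    = []
skipped m (suc i) = m ∷ skipped (2 + m) i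

-- top m i = m + 2i, in a form that unfolds along with skipped and next.
top : ℕ → ℕ → ℕ
top m zero    = m
top m (suc i) = top (2 + m) i

-- The new record `top (next p q) i` jumps over exactly these `i` values, which queue up behind the
-- older ones.
enqueue : ℕ → List ℕ → ℕ → List ℕ
enqueue p q i = q ++ skipped (next p q) i

-- Odd q p n w (Even q p n w): w is a possible remainder, of length n, of a word
-- whose next position is p, an odd (even) position of its block, with pending
-- values q.  An even position with nothing pending lies between two blocks.
mutual
  data Odd : List ℕ → ℕ → ℕ → List ℕ → Set where
    front : Even q (1 + p) n w → Odd (x ∷ q) p (suc n) (x ∷ w)
    leap  : ∀ i → z ≡ top (next p q) i → Even (enqueue p q i) (1 + p) n w →
            Odd q p (suc n) (z ∷ w)

  data Even : List ℕ → ℕ → ℕ → List ℕ → Set where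
    end     : Even [] p 0 []
    between : Odd [] p n w → Even [] p n w
    fixed   : Odd (x ∷ q) (1 + p) n w → Even (x ∷ q) p (suc n) (p ∷ w)

m≤top : ∀ m i → m ≤ top m i
m≤top m zero    = ≤-refl
m≤top m (suc i) = ≤-trans (m≤n+m m 2) (m≤top (2 + m) i)

top-< : ∀ m {i j} → i < j → top m i < top m j
top-< m {zero}  {suc j} _         = ≤-trans (n≤1+n (suc m)) (m≤top (2 + m) j)
top-< m {suc i} {suc j} (s≤s i<j) = top-< (2 + m) i<j

p≤next : ∀ p q → p ≤ next p q
p≤next p []      = ≤-refl
p≤next p (_ ∷ q) = ≤-trans (m≤n+m p 2) (p≤next (2 + p) q)

p≤top-next : ∀ p q i → p ≤ top (next p q) i
p≤top-next p q i = ≤-trans (p≤next p q) (m≤top (next p q) i)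

-- The entry at depth k leaves the queue at position p + 2k at the earliest, so the bound makes
-- every pending value appear after its own position.
Bounded : List ℕ → ℕ → Set
Bounded []      p = ⊤
Bounded (x ∷ q) p = x < p × Bounded q (2 + p)

bounded-skipped : ∀ m i → Bounded (skipped m i) (2 + m)
bounded-skipped m zero    = tt
bounded-skipped m (suc i) = s≤s (n≤1+n m) , bounded-skipped (2 + m) i

bounded-enqueue : ∀ p q i → Bounded q p → Bounded (enqueue p q i) (2 + p)
bounded-enqueue p []      i _         = bounded-skipped p i
bounded-enqueue p (x ∷ q) i (x<p , b) = m≤n⇒m≤o+n 2 x<p , bounded-enqueue (2 + p) q i b

-- With nothing pending, `p` is a block of length one, and the next block opens at `1 + p`.
fixed′ : Odd q (1 + p) n w → Even q p (suc n) (p ∷ w)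
fixed′ {[]}    o = between (leap 0 refl (between o))
fixed′ {_ ∷ _} o = fixed o

-- An entry other than `p` opens a block by a leap that skips `p`, and the fixed point after it is
-- smaller.
even-inv : Even q p n (y ∷ z ∷ w) →
           (y ≡ p × ∃[ m ] n ≡ suc m × Odd q (1 + p) m (z ∷ w)) ⊎ (q ≡ [] × p < y × z < y)
even-inv (fixed o)                              = inj₁ (refl , _ , refl , o)
even-inv (between (leap zero refl (between o))) = inj₁ (refl , _ , refl , o)
even-inv {p = p} (between (leap (suc i) refl (fixed _))) =
  inj₂ (refl , ≤-trans (n≤1+n (suc p)) (m≤top (2 + p) i) , m≤top (2 + p) i)

even-≥ : Even q p n (z ∷ w) → p ≤ z
even-≥ (fixed _)                         = ≤-refl
even-≥ {p = p} (between (leap i refl _)) = m≤top p i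

-- Closure under moves

-- Recursive in the place of the move, to follow the reading of the word entry by entry.
data Step : List ℕ → List ℕ → Set where
  here  : ∀ {v} → Monotone3 x y z → Step (x ∷ y ∷ z ∷ v) (z ∷ y ∷ x ∷ v)
  there : Step w w′ → Step (x ∷ w) (x ∷ w′)

move⇒step : Move w w′ → Step w w′
move⇒step (move []      v a b c m) = here m
move⇒step (move (x ∷ u) v a b c m) = there (move⇒step (move u v a b c m))

step-sym : Step w w′ → Step w′ w
step-sym (here (inj₁ (a<b , b<c))) = here (inj₂ (b<c , a<b))
step-sym (here (inj₂ (b<a , c<b))) = here (inj₁ (c<b , b<a))
step-sym (there s)                 = there (step-sym s)

¬peak : x ≤ y → z ≤ y → ¬ Monotone3 x y z
¬peak _   z≤y (inj₁ (_ , y<z)) = <⇒≱ y<z z≤y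
¬peak x≤y _   (inj₂ (y<x , _)) = <⇒≱ y<x x≤y

¬valley : y ≤ x → y ≤ z → ¬ Monotone3 x y z
¬valley y≤x _   (inj₁ (x<y , _)) = <⇒≱ x<y y≤x
¬valley _   y≤z (inj₂ (_ , z<y)) = <⇒≱ z<y y≤z

mutual
  -- A monotone triple is centred at a fixed point, with the front of the queue on one side and a
  -- new record on the other. Either order leaves the same queue, so the rest is read as before. All
  -- other triples are peaks or valleys.
  odd-step : Bounded q p → Odd q p n w → Step w w′ → Odd q p n w′
  odd-step {q = _ ∷ _} (_ , b) (front e) (there s) = front (even-step b e s)
  odd-step {q = q} b (leap i eq e) (there s) =
    leap i eq (even-step (bounded-enqueue _ q i b) e s)
  odd-step {q = _ ∷ _} (x<p , _) (front e) (here m) with even-inv e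
  ... | inj₂ (refl , p<y , z<y) =
    ⊥-elim (¬peak (<⇒≤ (<-trans x<p (<-trans ≤-refl p<y))) (<⇒≤ z<y) m)
  odd-step {q = _ ∷ _ ∷ _} (x<p , z<2+p , _) (front e) (here m) | inj₁ (refl , _ , refl , front _) =
    ⊥-elim (¬peak (m≤n⇒m≤1+n (<⇒≤ x<p)) (≤-pred z<2+p) m)
  odd-step {q = _ ∷ _} _ (front e) (here m) | inj₁ (refl , _ , refl , leap j eq e′) =
    leap j eq (fixed (front e′))
  odd-step {q = []} _ (leap zero refl e) (here m) with even-inv e
  -- With nothing pending, `p` itself acts as the front; the leap now skips `p` as well, hence
  -- `suc j`.
  ... | inj₁ (refl , _ , refl , leap j eq e′) = leap (suc j) eq (fixed (front e′))
  ... | inj₂ (_ , p<y , z<y) = ⊥-elim (¬peak (<⇒≤ (<-trans ≤-refl p<y)) (<⇒≤ z<y) m)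
  odd-step {q = []} _ (leap (suc i) refl (fixed (front e))) (here m) =
    leap 0 refl (fixed′ (leap i refl e))
  odd-step {q = []} {p} _ (leap (suc i) refl (fixed (leap j refl _))) (here m) =
    ⊥-elim (¬valley (<⇒≤ (m≤top (2 + p) i)) (<⇒≤ (p≤top-next (2 + p) (p ∷ skipped (2 + p) i) j)) m)
  odd-step {q = x ∷ q} _ (leap i refl (fixed (front e))) (here m) =
    -- `fixed′` allows for an empty `q`, when the block is cut after `x`.
    front (fixed′ (leap i refl e))
  odd-step {q = x ∷ q} {p} _ (leap i refl (fixed (leap j refl _))) (here m) =
    ⊥-elim (¬valley (<⇒≤ (p≤top-next (2 + p) q i))
                    (<⇒≤ (p≤top-next (2 + p) (enqueue p (x ∷ q) i) j)) m)

  -- With values pending, the centre of a triple starting here is the front of the queue, a valley,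
  -- or a new record, a peak.
  even-step : Bounded q (1 + p) → Even q p n w → Step w w′ → Even q p n w′
  even-step b (between o) s         = between (odd-step b o s)
  even-step b (fixed o)   (there s) = fixed (odd-step b o s)
  even-step (x≤p , _) (fixed (front e)) (here m) =
    ⊥-elim (¬valley (≤-pred x≤p) (≤-trans (≤-pred x≤p) (≤-trans (m≤n+m _ 2) (even-≥ e))) m)
  even-step {q = _ ∷ q} {p} _ (fixed (leap i refl (fixed _))) (here m) =
    ⊥-elim (¬peak (≤-trans (m≤n+m p 3) (p≤top-next (3 + p) q i))
                  (<⇒≤ (p≤top-next (3 + p) q i)) m)

even-equiv : Equiv w w′ → Even [] p n w → Even [] p n w′
even-equiv ε            e = e
even-equiv (fwd m ◅ ms) e = even-equiv ms (even-step tt e (move⇒step m))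
even-equiv (bwd m ◅ ms) e = even-equiv ms (even-step tt e (step-sym (move⇒step m)))

-- Sorting by moves

∷-equiv : ∀ x → Equiv w w′ → Equiv (x ∷ w) (x ∷ w′)
∷-equiv x = gmap (x ∷_) λ { (move u v a b c m) → move (x ∷ u) v a b c m }

-- The smallest value available at position p is the front of the queue, or p.
least : List ℕ → ℕ → ℕ
least []      p = p
least (x ∷ _) p = x

afterLeast : List ℕ → List ℕ
afterLeast []      = []
afterLeast (_ ∷ q) = q

-- If the least available value is not first, recursion brings it to the next odd position, two
-- places on, and one descending move then brings it to the front.
sort-head : Bounded q p → Odd q p (suc n) w →
            ∃[ v ] Equiv w (least q p ∷ v) × Even (afterLeast q) (1 + p) n v
sort-head {q = _ ∷ _} _ (front e) = _ , ε , e
sort-head {q = []} _ (leap zero refl e) = _ , ε , e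
sort-head {q = []} {p} b (leap (suc i) refl (fixed {n = suc _} o)) =
  let v , w~v , e = sort-head (bounded-enqueue p [] (suc i) b) o
  in _ , ∷-equiv _ (∷-equiv _ w~v) ◅◅
         return (move [] v _ _ _ (inj₂ (m≤top (2 + p) i , ≤-refl))) ,
     fixed′ (leap i refl e)
sort-head {q = x ∷ q} {p} b@(x<p , _) (leap i refl (fixed {n = suc _} o)) =
  let v , w~v , e = sort-head (bounded-enqueue p (x ∷ q) i b) o
  in _ , ∷-equiv _ (∷-equiv _ w~v) ◅◅
         return (move [] v _ _ _ (inj₂ (p≤top-next (2 + p) q i , m≤n⇒m≤1+n x<p))) ,
     fixed′ (leap i refl e)

bounded-afterLeast : ∀ q → Bounded q p → Bounded (afterLeast q) (2 + p)
bounded-afterLeast []      _       = tt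
bounded-afterLeast (_ ∷ _) (_ , b) = b

mutual
  -- Sorting gives both words the same head and both tails the same state. The recursion is on `n`
  -- because sorting replaces the derivations.
  odd-connected : ∀ n → Bounded q p → Odd q p n w → Odd q p n w′ → Equiv w w′
  odd-connected zero    _ ()
  odd-connected {q} {p} (suc n) b o o′ =
    let v  , w~v   , e  = sort-head b o
        v′ , w′~v′ , e′ = sort-head b o′
    in w~v ◅◅ ∷-equiv (least q p) (even-connected n (bounded-afterLeast q b) e e′) ◅◅
       symmetric Move w′~v′

  even-connected : ∀ n → Bounded q (1 + p) → Even q p n w → Even q p n w′ → Equiv w w′
  even-connected _       _ end         end          = ε
  even-connected n       _ (between o) (between o′) = odd-connected n tt o o′
  even-connected (suc n) b (fixed o)   (fixed o′)   = ∷-equiv _ (odd-connected n b o o′)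

-- Every entry is a block of length one. A general `f` is taken because `applyUpTo` shifts its
-- function.
ident-even : ∀ (f : ℕ → ℕ) p → (∀ i → f i ≡ i + p) → ∀ n → Even [] p n (applyUpTo f n)
ident-even f p f≡ zero    = end
ident-even f p f≡ (suc n) =
  between (leap 0 (f≡ 0) (ident-even (f ∘ suc) (1 + p) (λ i → trans (f≡ (suc i)) (sym (+-suc i p))) n))

equiv⇒↭ : Equiv w w′ → w ↭ w′
equiv⇒↭ = fold ↭-isEquivalence λ { (move u v a b c _) → ↭-++⁺ˡ u (reverse₃ a b c) }
  where
  reverse₃ : ∀ a b c {v} → a ∷ b ∷ c ∷ v ↭ c ∷ b ∷ a ∷ v
  reverse₃ a b c = ↭-trans (swap a b ↭-refl) (↭-trans (prep b (swap a c ↭-refl)) (swap b c ↭-refl))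

-- Enumeration

mutual
  odds : List ℕ → ℕ → ℕ → List (List ℕ)
  odds q p zero    = []
  -- A leap over more than `n` values would leave too few entries to use them up.
  odds q p (suc n) = fronts q p n ++ concat (applyUpTo (leaps q p n) (suc n))

  fronts : List ℕ → ℕ → ℕ → List (List ℕ)
  fronts []      p n = []
  fronts (x ∷ q) p n = map (x ∷_) (evens q (1 + p) n)

  leaps : List ℕ → ℕ → ℕ → ℕ → List (List ℕ)
  leaps q p n i = map (top (next p q) i ∷_) (evens (enqueue p q i) (1 + p) n)

  evens : List ℕ → ℕ → ℕ → List (List ℕ)
  evens []      p zero    = [] ∷ []
  evens []      p (suc n) = odds [] p (suc n)
  evens (_ ∷ _) p zero    = []
  evens (x ∷ q) p (suc n) = map (p ∷_) (odds (x ∷ q) (1 + p) n)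

length-skipped : ∀ m i → length (skipped m i) ≡ i
length-skipped m zero    = refl
length-skipped m (suc i) = cong suc (length-skipped (2 + m) i)

length-enqueue : ∀ p q i → length (enqueue p q i) ≡ length q + i
length-enqueue p q i = trans (length-++ q) (cong (length q +_) (length-skipped _ i))

mutual
  odd-length : Odd q p n w → length q ≤ n
  odd-length (front e)        = s≤s (even-length e)
  odd-length {q} (leap i _ e) = m≤n⇒m≤1+n (m+n≤o⇒m≤o (length q) (enqueue-length q i e))

  enqueue-length : ∀ q i → Even (enqueue p q i) (1 + p) n w → length q + i ≤ n
  enqueue-length {p} q i e = subst (_≤ _) (length-enqueue p q i) (even-length e)

  even-length : Even q p n w → length q ≤ n
  even-length end         = z≤n
  even-length (between _) = z≤n
  even-length (fixed o)   = m≤n⇒m≤1+n (odd-length o)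

mutual
  ∈-odds⁺ : Odd q p n w → w ∈ odds q p n
  ∈-odds⁺ (front e) = ∈-++⁺ˡ (∈-map⁺ _ (∈-evens⁺ e))
  ∈-odds⁺ {q} {p} {suc n} (leap i refl e) =
    ∈-++⁺ʳ (fronts q p n)
      (∈-concat⁺′ (∈-map⁺ _ (∈-evens⁺ e))
        (∈-applyUpTo⁺ (leaps q p n) (s≤s (m+n≤o⇒n≤o (length q) (enqueue-length q i e)))))

  ∈-evens⁺ : Even q p n w → w ∈ evens q p n
  ∈-evens⁺ end                     = here refl
  ∈-evens⁺ {n = suc n} (between o) = ∈-odds⁺ o
  ∈-evens⁺ (fixed o)               = ∈-map⁺ _ (∈-odds⁺ o)

mutual
  ∈-odds⁻ : ∀ q p n → w ∈ odds q p n → Odd q p n w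
  ∈-odds⁻ q p (suc n) w∈ with ∈-++⁻ (fronts q p n) w∈
  ... | inj₁ w∈fronts = ∈-fronts⁻ q p n w∈fronts
  ... | inj₂ w∈leaps with ∈-concat⁻′ (applyUpTo (leaps q p n) (suc n)) w∈leaps
  ... | _ , w∈l , l∈ with ∈-applyUpTo⁻ (leaps q p n) l∈
  ... | i , _ , refl with ∈-map⁻ (top (next p q) i ∷_) w∈l
  ... | _ , v∈ , refl = leap i refl (∈-evens⁻ (enqueue p q i) (1 + p) n v∈)

  ∈-fronts⁻ : ∀ q p n → w ∈ fronts q p n → Odd q p (suc n) w
  ∈-fronts⁻ (x ∷ q) p n w∈ with ∈-map⁻ (x ∷_) w∈
  ... | _ , v∈ , refl = front (∈-evens⁻ q (1 + p) n v∈)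

  ∈-evens⁻ : ∀ q p n → w ∈ evens q p n → Even q p n w
  ∈-evens⁻ []      p zero    (here refl) = end
  ∈-evens⁻ []      p (suc n) w∈          = between (∈-odds⁻ [] p (suc n) w∈)
  ∈-evens⁻ (x ∷ q) p (suc n) w∈ with ∈-map⁻ (p ∷_) w∈
  ... | _ , v∈ , refl = fixed (∈-odds⁻ (x ∷ q) (1 + p) n v∈)

map-∷-disjoint : ∀ {x y} {xss yss : List (List ℕ)} → x < y → Disjoint (map (x ∷_) xss) (map (y ∷_) yss)
map-∷-disjoint x<y (v∈ , v∈′) with ∈-map⁻ _ v∈ | ∈-map⁻ _ v∈′
... | _ , _ , refl | _ , _ , eq = <⇒≢ x<y (∷-injectiveˡ eq)

mutual
  odds-unique : ∀ q p n → Bounded q p → Unique (odds q p n)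
  odds-unique q p zero    b = []
  odds-unique q p (suc n) b =
    ++⁺ (fronts-unique q p n b)
        (concat⁺ (All-applyUpTo⁺ (leaps q p n) (suc n) (λ i → leaps-unique q p n i b))
                 (AllPairs-applyUpTo⁺ (leaps q p n) (suc n)
                   (λ i<j _ → map-∷-disjoint (top-< (next p q) i<j))))
        (fronts-leaps-disjoint q p n b)

  fronts-unique : ∀ q p n → Bounded q p → Unique (fronts q p n)
  fronts-unique []      p n _       = []
  fronts-unique (x ∷ q) p n (_ , b) = map⁺ ∷-injectiveʳ (evens-unique q (1 + p) n b)

  leaps-unique : ∀ q p n i → Bounded q p → Unique (leaps q p n i)
  leaps-unique q p n i b =
    map⁺ ∷-injectiveʳ (evens-unique (enqueue p q i) (1 + p) n (bounded-enqueue p q i b))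

  -- Pending values lie below `p`, new records do not.
  fronts-leaps-disjoint : ∀ q p n → Bounded q p →
    Disjoint (fronts q p n) (concat (applyUpTo (leaps q p n) (suc n)))
  fronts-leaps-disjoint q@(x ∷ _) p n (x<p , _) (v∈ , v∈′)
    with ∈-concat⁻′ (applyUpTo (leaps q p n) (suc n)) v∈′
  ... | _ , v∈l , l∈ with ∈-applyUpTo⁻ (leaps q p n) l∈
  ... | i , _ , refl = map-∷-disjoint (<-≤-trans x<p (p≤top-next p q i)) (v∈ , v∈l)

  evens-unique : ∀ q p n → Bounded q (1 + p) → Unique (evens q p n)
  evens-unique []      p zero    _ = [] ∷ []
  evens-unique []      p (suc n) b = odds-unique [] p (suc n) b
  evens-unique (_ ∷ _) p zero    _ = []
  evens-unique (x ∷ q) p (suc n) b = map⁺ ∷-injectiveʳ (odds-unique (x ∷ q) (1 + p) n b)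

-- Counting

-- choose n h k = C(n − h, k), but 0 when n < h.
choose : ℕ → ℕ → ℕ → ℕ
choose n       zero    k = n C k
choose zero    (suc h) k = 0
choose (suc n) (suc h) k = choose n h k

choose-pascal : ∀ n h k → choose n h k + choose n h (suc k) ≡ choose (suc n) h (suc k)
choose-pascal n       zero          k = nCk+nC[k+1]≡[n+1]C[k+1] n k
choose-pascal zero    (suc zero)    k = refl
choose-pascal zero    (suc (suc h)) k = refl
choose-pascal (suc n) (suc h)       k = choose-pascal n h k

choose-zero : ∀ n h k → choose n (suc (n + h)) k ≡ 0
choose-zero zero    h k = refl
choose-zero (suc n) h k = choose-zero n h k

-- The first argument is the length of a remainder at an even position, the second the number of
-- pending values.
count : ℕ → ℕ → ℕ
count zero    zero    = 1
count zero    (suc h) = 0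
count (suc r) h       = choose r h ⌊ r /2⌋

-- Two more entries raise the lower index by one, and the shifts of `h` cancel against them, which
-- leaves Pascal's rule.
count-pascal : ∀ r h → count r h + count (2 + r) (2 + h) ≡ count (2 + r) (1 + h)
count-pascal zero    zero    = refl
count-pascal zero    (suc h) = refl
count-pascal (suc r) h       = choose-pascal r h ⌊ r /2⌋

central-symmetric : ∀ r → r C ⌈ r /2⌉ ≡ r C ⌊ r /2⌋
central-symmetric r = sym (trans (nCk≡nC[n∸k] (⌊n/2⌋≤n r)) (cong (r C_) r∸⌊r/2⌋))
  where
  r∸⌊r/2⌋ : r ∸ ⌊ r /2⌋ ≡ ⌈ r /2⌉
  r∸⌊r/2⌋ = trans (cong (_∸ ⌊ r /2⌋) (sym (⌊n/2⌋+⌈n/2⌉≡n r))) (m+n∸m≡n ⌊ r /2⌋ ⌈ r /2⌉)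

-- By `count-pascal` each summand is a difference of consecutive values of `count (2 + r)`, so the
-- sum telescopes. The last value stands on the left to avoid subtraction.
length-concat-applyUpTo : ∀ {A : Set} (f : ℕ → List A) r h →
  (∀ i → length (f i) ≡ count r (h + i)) → ∀ k →
  length (concat (applyUpTo f k)) + count (2 + r) (1 + h + k) ≡ count (2 + r) (1 + h)
length-concat-applyUpTo f r h eq zero    = cong (count (2 + r) ∘ suc) (+-identityʳ h)
length-concat-applyUpTo f r h eq (suc k) = begin
  length (f 0 ++ rest) + count (2 + r) (1 + h + suc k)
    ≡⟨ cong₂ _+_ (length-++ (f 0)) (cong (count (2 + r) ∘ suc) (+-suc h k)) ⟩
  length (f 0) + length rest + count (2 + r) (2 + h + k)
    ≡⟨ +-assoc (length (f 0)) (length rest) _ ⟩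
  length (f 0) + (length rest + count (2 + r) (2 + h + k))
    ≡⟨ cong₂ _+_ (trans (eq 0) (cong (count r) (+-identityʳ h)))
                 (length-concat-applyUpTo (f ∘ suc) r (suc h)
                   (λ i → trans (eq (suc i)) (cong (count r) (+-suc h i))) k) ⟩
  count r h + count (2 + r) (2 + h)
    ≡⟨ count-pascal r h ⟩
  count (2 + r) (1 + h) ∎
  where
  open ≡-Reasoning
  rest = concat (applyUpTo (f ∘ suc) k)

mutual
  length-evens : ∀ q p n → length (evens q p n) ≡ count n (length q)
  length-evens []      p zero          = refl
  -- With nothing pending there are only leaps; they sum to the coefficient with lower index
  -- `⌈ n /2⌉`, the mirror image of the wanted one.
  length-evens []      p (suc n)       = trans (length-all-leaps [] p n) (central-symmetric n)
  length-evens (_ ∷ _) p zero          = refl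
  length-evens (_ ∷ _) p (suc zero)    = refl
  length-evens (x ∷ q) p (suc (suc n)) = begin
    length (map (p ∷_) (odds (x ∷ q) (1 + p) (suc n)))
      ≡⟨ length-map (p ∷_) (odds (x ∷ q) (1 + p) (suc n)) ⟩
    length (fronts (x ∷ q) (1 + p) n ++ all)
      ≡⟨ length-++ (fronts (x ∷ q) (1 + p) n) ⟩
    length (fronts (x ∷ q) (1 + p) n) + length all
      -- Either the front follows the fixed point `p`, or a new record does.
      ≡⟨ cong₂ _+_ (trans (length-map (x ∷_) (evens q (2 + p) n)) (length-evens q (2 + p) n))
                   (length-all-leaps (x ∷ q) (1 + p) n) ⟩
    count n (length q) + count (2 + n) (2 + length q)
      ≡⟨ count-pascal n (length q) ⟩
    count (2 + n) (1 + length q) ∎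
    where
    open ≡-Reasoning
    all = concat (applyUpTo (leaps (x ∷ q) (1 + p) n) (suc n))

  length-all-leaps : ∀ q p n →
    length (concat (applyUpTo (leaps q p n) (suc n))) ≡ count (2 + n) (1 + length q)
  length-all-leaps q p n = begin
    length all
      ≡⟨ +-identityʳ (length all) ⟨
    length all + 0
      ≡⟨ cong (length all +_) out-of-range ⟨
    length all + count (2 + n) (1 + length q + suc n)
      ≡⟨ length-concat-applyUpTo (leaps q p n) n (length q) (length-leaps q p n) (suc n) ⟩
    count (2 + n) (1 + length q) ∎
    where
    open ≡-Reasoning
    all = concat (applyUpTo (leaps q p n) (suc n))
    -- The end of the telescope: `length q + suc n` exceeds `n`, where `choose` is 0.
    out-of-range : count (2 + n) (1 + length q + suc n) ≡ 0
    out-of-range = trans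
      (cong (λ h → choose n h ⌊ suc n /2⌋) (trans (+-suc (length q) n) (cong suc (+-comm (length q) n))))
      (choose-zero n (length q) ⌊ suc n /2⌋)

  length-leaps : ∀ q p n i → length (leaps q p n i) ≡ count n (length q + i)
  length-leaps q p n i = begin
    length (leaps q p n i)
      ≡⟨ length-map (top (next p q) i ∷_) (evens (enqueue p q i) (1 + p) n) ⟩
    length (evens (enqueue p q i) (1 + p) n)
      ≡⟨ length-evens (enqueue p q i) (1 + p) n ⟩
    count n (length (enqueue p q i))
      ≡⟨ cong (count n) (length-enqueue p q i) ⟩
    count n (length q + i) ∎
    where open ≡-Reasoning

n/2≡⌊n/2⌋ : ∀ n → n / 2 ≡ ⌊ n /2⌋
n/2≡⌊n/2⌋ zero          = refl
n/2≡⌊n/2⌋ (suc zero)    = refl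
n/2≡⌊n/2⌋ (suc (suc n)) = trans (m/n≡1+[m∸n]/n {2 + n} {2} (s≤s (s≤s z≤n))) (cong suc (n/2≡⌊n/2⌋ n))

theorem3p3 : (n : ℕ) → 1 ≤ n →
    Σ (List (List ℕ)) λ L →
    Unique L ×
    (∀ π → (π ∈ L) ⇔ (IsPerm n π × Equiv π (ident n))) ×
    length L ≡ (n ∸ 1) C ((n ∸ 1) / 2)
theorem3p3 (suc r) _ =
  evens [] 0 (suc r) ,
  evens-unique [] 0 (suc r) tt ,
  (λ π → mk⇔ (sound π) (complete π)) ,
  trans (length-evens [] 0 (suc r)) (cong (r C_) (sym (n/2≡⌊n/2⌋ r)))
  where
  identity : Even [] 0 (suc r) (ident (suc r))
  identity = ident-even (λ i → i) 0 (λ i → sym (+-identityʳ i)) (suc r)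

  sound : ∀ π → π ∈ evens [] 0 (suc r) → IsPerm (suc r) π × Equiv π (ident (suc r))
  sound π π∈ = equiv⇒↭ π~ι , π~ι
    where
    π~ι : Equiv π (ident (suc r))
    π~ι = even-connected (suc r) tt (∈-evens⁻ [] 0 (suc r) π∈) identity

  complete : ∀ π → IsPerm (suc r) π × Equiv π (ident (suc r)) → π ∈ evens [] 0 (suc r)
  complete π (_ , π~ι) = ∈-evens⁺ (even-equiv (symmetric Move π~ι) identity)
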